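{- Let $x,y,z$ be pairwise distinct variables. The following three formulas are incoherent: (1) $\mathrm{dep}(x,y)\lor\mathrm{dep}(y,x)$; (2) $\mathrm{dep}(x,y)\lor\mathrm{dep}(y,z)$; (3) $\mathrm{dep}(x,z)\lor\mathrm{dep}(y,z)$.
   Context: A team $T$ with domain $X$ (a finite set of variables) and range $A$ is a set of assignments $s\colon X\to A$. $T\models\mathrm{dep}(v,w)$ iff for all $s_1,s_2\in T$ with $s_1(v)=s_2(v)$ we have $s_1(w)=s_2(w)$. $T\models\varphi_1\lor\varphi_2$ iff there are teams $T_1,T_2$ with $T=T_1\cup T_2$, $T_1\models\varphi_1$ and $T_2\models\varphi_2$. For $k\in\mathbb N$, $\varphi$ is $k$-coherent if for every team $T$ whose domain contains the variables of $\varphi$: $T\models\varphi$ iff every sub-team $S\subseteq T$ with at most $k$ elements satisfies $S\models\varphi$. $\varphi$ is incoherent if there is no $k\in\mathbb N$ such that $\varphi$ is $k$-coherent. -}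

module Defs where

open import Data.List.Base using (List; []; _∷_; _++_; length)
open import Data.List.Membership.Propositional using (_∈_)
open import Data.List.Relation.Binary.Subset.Propositional using (_⊆_)
open import Data.List.Relation.Binary.Subset.Propositional.Properties
  using (xs⊆xs++ys; xs⊆ys++xs)
open import Data.List.Relation.Unary.Any using (Any; here; there)
open import Data.Nat.Base using (ℕ; _≤_)
open import Data.Product.Base using (_×_; ∃-syntax)
open import Function.Bundles using (_⇔_)
open import Level using (0ℓ; Lift)
open import Relation.Binary.Definitions using (_Respects_)
open import Relation.Binary.PropositionalEquality using (_≡_; refl)
open import Relation.Nullary.Negation using (¬_)
open import Relation.Unary as U using (Pred; _∪_; _≐_)

infixr 5 _∨_

data Formula (Var : Set) : Set where
  dep : Var → Var → Formula Var
  _∨_ : Formula Var → Formula Var → Formula Var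

private
  variable
    Var A : Set
    X : List Var

vars : Formula Var → List Var
vars (dep v w) = v ∷ w ∷ []
vars (φ ∨ ψ)   = vars φ ++ vars ψ

-- A list stands for the finite set of its entries: since membership proofs
-- are irrelevant, order and repetitions in X do not affect assignments.
Assignment : {Var : Set} → List Var → Set → Set
Assignment X A = ∀ v → .(v ∈ X) → A

infix 4 _≈_

_≈_ : Assignment X A → Assignment X A → Set
_≈_ {X = X} s t = ∀ v .(v∈X : v ∈ X) → s v v∈X ≡ t v v∈X

-- Without function extensionality, a set of assignments is a predicate that
-- respects pointwise equality.
record Team {Var : Set} (X : List Var) (A : Set) : Set₁ where
  field
    member : Pred (Assignment X A) 0ℓ
    resp   : member Respects _≈_

open Team public

_⊨_[_] : Team X A → (φ : Formula Var) → .(vars φ ⊆ X) → Set₁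
T ⊨ dep v w [ p ] = Lift _ (∀ s₁ s₂ → member T s₁ → member T s₂ →
  s₁ v (p (here refl)) ≡ s₂ v (p (here refl)) →
  s₁ w (p (there (here refl))) ≡ s₂ w (p (there (here refl))))
T ⊨ φ ∨ ψ [ p ] = ∃[ T₁ ] ∃[ T₂ ]
  member T ≐ member T₁ ∪ member T₂ ×
  T₁ ⊨ φ [ (λ i → p (xs⊆xs++ys (vars φ) (vars ψ) i)) ] ×
  T₂ ⊨ ψ [ (λ i → p (xs⊆ys++xs (vars ψ) (vars φ) i)) ]

AtMost : ℕ → Team X A → Set
AtMost k S = ∃[ L ] length L ≤ k × member S ≐ (λ s → Any (s ≈_) L)

Coherent : ℕ → Formula Var → Set₁
Coherent {Var} k φ =
  (X : List Var) (A : Set) (T : Team X A) (p : vars φ ⊆ X) →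
  T ⊨ φ [ p ] ⇔
  ((S : Team X A) → member S U.⊆ member T → AtMost k S → S ⊨ φ [ p ])

Incoherent : Formula Var → Set₁
Incoherent φ = ¬ (∃[ k ] Coherent k φ)

{-# OPTIONS --safe #-}

-- Read a pair (a , b) as an edge between a row vertex a and a column vertex b,
-- and as the assignment x ↦ a, y ↦ b, z ↦ a + b.  Since any two of a, b and
-- a + b determine the edge, each of the three formulas says that the edges
-- split into a class with at most one edge per row vertex and a class with at
-- most one edge per column vertex, that is, every edge can be charged
-- injectively to one of its ends.  A theta graph has one edge more than it has
-- vertices, so this is impossible; deleting an edge of one of its three paths
-- makes it possible, and any k edges miss an edge of that path if it is long.

module Submission where

open import Data.Empty using (⊥)
open import Data.Fin.Base using (Fin; toℕ)
open import Data.Fin.Properties as Fin using (toℕ<n; toℕ-injective; pigeonhole; ¬∀⟶∃¬)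
open import Data.List.Base using (List; length; lookup; map)
open import Data.List.Membership.DecPropositional using () renaming (_∈?_ to mem?)
open import Data.List.Membership.Propositional using (_∈_; _∉_)
open import Data.List.Properties using (length-map)
open import Data.List.Relation.Unary.Any as Any using (here; there; index)
open import Data.List.Relation.Unary.Any.Properties using (map⁺; lookup-index)
open import Data.Nat.Base using (ℕ; zero; suc; _+_; _≤_; _<_; z≤n; s≤s; s≤s⁻¹)
open import Data.Nat.Properties
  using (_≟_; _≤?_; <-cmp; ≤-refl; ≤-reflexive; ≤-trans; ≤⇒≯; ≰⇒>; n≮n; n<1+n;
         m≤n⇒m≤1+n; 1+n≢n; 1+n≢0; +-cancelˡ-≡; +-cancelʳ-≡)
open import Data.Product.Base using (_×_; _,_; proj₁; proj₂; ∃-syntax)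
open import Data.Product.Properties using (≡-dec)
open import Data.Sum.Base using (_⊎_; inj₁; inj₂; [_,_]′)
open import Function.Base using (id; _∘_)
open import Function.Bundles using (module Equivalence)
open import Function.Definitions using (Injective)
open import Level using (0ℓ; lift)
open import Relation.Binary.Definitions using (DecidableEquality; tri<; tri≈; tri>)
open import Relation.Binary.PropositionalEquality
  using (_≡_; _≢_; refl; sym; trans; cong; cong₂; subst; module ≡-Reasoning)
open import Relation.Nullary.Decidable using (yes; no)
open import Relation.Nullary.Negation using (¬_; contradiction)
open import Relation.Unary as U using (Pred; _∪_)
open import Defs

-- Pigeonhole: `length L + 1` distinct values cannot all sit at positions of `L`. This supplies the
-- edge to delete.
injection-avoids : {B : Set} → DecidableEquality B →
  (f : ℕ → B) → Injective _≡_ _≡_ f →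
  (L : List B) → ∃[ i ] i ≤ length L × f i ∉ L
injection-avoids _≟B_ f f-inj L
  with ¬∀⟶∃¬ (suc (length L)) (λ i → f (toℕ i) ∈ L) (λ i → mem? _≟B_ (f (toℕ i)) L) not-all
  where
  not-all : ¬ (∀ (i : Fin (suc (length L))) → f (toℕ i) ∈ L)
  not-all all∈ with pigeonhole (n<1+n (length L)) (index ∘ all∈)
  ... | i , j , i<j , same = Fin.<⇒≢ i<j (toℕ-injective (f-inj (begin
    f (toℕ i)                  ≡⟨ lookup-index (all∈ i) ⟩
    lookup L (index (all∈ i))  ≡⟨ cong (lookup L) same ⟩
    lookup L (index (all∈ j))  ≡⟨ lookup-index (all∈ j) ⟨
    f (toℕ j)                  ∎)))
    where open ≡-Reasoning
... | i , fi∉L = toℕ i , s≤s⁻¹ (toℕ<n i) , fi∉L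

Edge : Set
Edge = ℕ × ℕ

-- For n > 0 these are three paths between the column vertices 0 and n: one
-- through the row vertex 0, one through the row vertex n + 1, and a staircase
-- through all the remaining vertices.
data Theta (n : ℕ) : Pred Edge 0ℓ where
  diag  : ∀ {j} → j ≤ n → Theta n (j , j)
  sub   : ∀ {j} → j ≤ n → Theta n (suc j , j)
  left  : Theta n (0 , n)
  right : Theta n (suc n , 0)

OnePerRow OnePerColumn : Pred Edge 0ℓ → Set
OnePerRow    R = ∀ {a b b′} → R (a , b) → R (a , b′) → b ≡ b′
OnePerColumn C = ∀ {a a′ b} → C (a , b) → C (a′ , b) → a ≡ a′

Theta-no-split : ∀ {n} {R C : Pred Edge 0ℓ} →
  Theta (suc n) U.⊆ R ∪ C → OnePerRow R → OnePerColumn C → ⊥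
Theta-no-split {n} {R} {C} cover oneR oneC = [ 10∉R , 10∉C ]′ (cover (sub z≤n))
  where
  -- A vertex charged by one edge forces every other edge there onto its opposite end.
  R⇒C : ∀ {a b b′} → b ≢ b′ → R (a , b) → Theta (suc n) (a , b′) → C (a , b′)
  R⇒C b≢b′ r t = [ (λ r′ → contradiction (oneR r r′) b≢b′) , id ]′ (cover t)

  C⇒R : ∀ {a a′ b} → a ≢ a′ → C (a , b) → Theta (suc n) (a′ , b) → R (a′ , b)
  C⇒R a≢a′ c t = [ id , (λ c′ → contradiction (oneC c c′) a≢a′) ]′ (cover t)

  10∉R : ¬ R (1 , 0)
  10∉R 10∈R = contradiction (oneC 00∈C right∈C) λ ()
    where
    -- The forcing runs along the whole staircase; from its far end the other two paths carry it
    -- back, and both charge column `0`.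
    sub∈R : ∀ {j} → j ≤ suc n → R (suc j , j)
    diag∈C : ∀ {j} → j ≤ n → C (suc j , suc j)
    sub∈R {zero}  _   = 10∈R
    sub∈R {suc j} j≤n = C⇒R (1+n≢n ∘ sym) (diag∈C (s≤s⁻¹ j≤n)) (sub j≤n)
    diag∈C j≤n = R⇒C (1+n≢n ∘ sym) (sub∈R (m≤n⇒m≤1+n j≤n)) (diag (s≤s j≤n))

    right∈C : C (suc (suc n) , 0)
    right∈C = R⇒C 1+n≢0 (sub∈R ≤-refl) right

    00∈C : C (0 , 0)
    00∈C = R⇒C 1+n≢0 (C⇒R 1+n≢0 (diag∈C ≤-refl) left) (diag z≤n)

  10∉C : ¬ C (1 , 0)
  10∉C 10∈C = contradiction (oneC left∈C corner∈C) λ ()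
    where
    -- With column `0` taken, the other two paths are forced away from it and collide at column
    -- `suc n`.
    left∈C : C (0 , suc n)
    left∈C = R⇒C (λ ()) (C⇒R (λ ()) 10∈C (diag z≤n)) left

    corner∈C : C (suc (suc n) , suc n)
    corner∈C = R⇒C (λ ()) (C⇒R (λ ()) 10∈C right) (sub ≤-refl)

-- The charging of Theta n without (i , i): along the staircase, every edge is
-- charged to the end nearer to (i , i).
data ByRow (n i : ℕ) : Pred Edge 0ℓ where
  diag  : ∀ {j} → i < j → j ≤ n → ByRow n i (j , j)
  sub   : ∀ {j} → j < i → ByRow n i (suc j , j)
  left  : ByRow n i (0 , n)
  right : ByRow n i (suc n , 0)

data ByColumn (i : ℕ) : Pred Edge 0ℓ where
  diag : ∀ {j} → j < i → ByColumn i (j , j)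
  sub  : ∀ {j} → i ≤ j → ByColumn i (suc j , j)

-- `sub` uses rows `1` to `i`, `diag` rows `i + 1` to `n`, and `left` and `right` the outer rows `0`
-- and `n + 1`.
ByRow-onePerRow : ∀ {n i} → i ≤ n → OnePerRow (ByRow n i)
ByRow-onePerRow i≤n (diag _ _)     (diag _ _)     = refl
ByRow-onePerRow i≤n (diag i<1+j _) (sub j<i)      = contradiction j<i (≤⇒≯ (s≤s⁻¹ i<1+j))
ByRow-onePerRow i≤n (diag _ n<n)   right          = contradiction n<n (n≮n _)
ByRow-onePerRow i≤n (sub j<i)      (diag i<1+j _) = contradiction j<i (≤⇒≯ (s≤s⁻¹ i<1+j))
ByRow-onePerRow i≤n (sub _)        (sub _)        = refl
ByRow-onePerRow i≤n (sub n<i)      right          = contradiction n<i (≤⇒≯ i≤n)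
ByRow-onePerRow i≤n left           left           = refl
ByRow-onePerRow i≤n right          (diag _ n<n)   = contradiction n<n (n≮n _)
ByRow-onePerRow i≤n right          (sub n<i)      = contradiction n<i (≤⇒≯ i≤n)
ByRow-onePerRow i≤n right          right          = refl

ByColumn-onePerColumn : ∀ {i} → OnePerColumn (ByColumn i)
ByColumn-onePerColumn (diag _)   (diag _)   = refl
ByColumn-onePerColumn (diag j<i) (sub i≤j)  = contradiction j<i (≤⇒≯ i≤j)
ByColumn-onePerColumn (sub i≤j)  (diag j<i) = contradiction j<i (≤⇒≯ i≤j)
ByColumn-onePerColumn (sub _)    (sub _)    = refl

Theta-split : ∀ {n i e} → Theta n e → e ≢ (i , i) → ByRow n i e ⊎ ByColumn i e
Theta-split {i = i} (diag {j} j≤n) e≢ with <-cmp i j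
... | tri< i<j _ _  = inj₁ (diag i<j j≤n)
... | tri≈ _ refl _ = contradiction refl e≢
... | tri> _ _ j<i  = inj₂ (diag j<i)
Theta-split {i = i} (sub {j} _) _ with i ≤? j
... | yes i≤j = inj₂ (sub i≤j)
... | no  i≰j = inj₁ (sub (≰⇒> i≰j))
Theta-split left  _ = inj₁ left
Theta-split right _ = inj₁ right

-- The common shape of the three formulas: by `w-inj` and `w′-inj`, on encoded edges `dep x w` says
-- one edge per row and `dep y w′` one edge per column.
incoherent : {Var : Set} (x y w w′ : Var) (val : Edge → Var → ℕ) →
  (∀ {e} → val e x ≡ proj₁ e) → (∀ {e} → val e y ≡ proj₂ e) →
  (∀ {a b b′} → val (a , b) w ≡ val (a , b′) w → b ≡ b′) →
  (∀ {a a′ b} → val (a , b) w′ ≡ val (a′ , b) w′ → a ≡ a′) →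
  Incoherent (dep x w ∨ dep y w′)
incoherent {Var} x y w w′ val val-x val-y w-inj w′-inj (k , coherent) =
  unsatisfied (Equivalence.from (coherent X ℕ T id) small-satisfied)
  where
  X : List Var
  X = vars (dep x w ∨ dep y w′)

  encode : Edge → Assignment X ℕ
  encode e v _ = val e v

  decode : Assignment X ℕ → Edge
  decode s = s x (here refl) , s y (there (there (here refl)))

  decode-cong : ∀ {s t} → s ≈ t → decode s ≡ decode t
  decode-cong s≈t = cong₂ _,_ (s≈t x (here refl)) (s≈t y (there (there (here refl))))

  decode-encode : ∀ e → decode (encode e) ≡ e
  decode-encode e = cong₂ _,_ val-x val-y

  T : Team X ℕ
  T = record
    -- The index `suc k` is positive, as `Theta-no-split` requires, and puts more than `k` edges on
    -- the diagonal. Using `≈` instead of `≡` lets `resp` hold without function extensionality.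
    { member = λ s → Theta (suc k) (decode s) × s ≈ encode (decode s)
    ; resp   = λ {s} {t} s≈t (θ , s≈) →
        subst (Theta (suc k)) (decode-cong s≈t) θ ,
        λ v v∈X → trans (sym (s≈t v v∈X))
          (trans (s≈ v v∈X) (cong (λ e → val e v) (decode-cong s≈t)))
    }

  encode∈T : ∀ {e} → Theta (suc k) e → member T (encode e)
  encode∈T {e} θ = subst (Theta (suc k)) (sym (decode-encode e)) θ ,
    λ v _ → cong (λ e′ → val e′ v) (sym (decode-encode e))

  unsatisfied : ¬ (T ⊨ dep x w ∨ dep y w′ [ id ])
  unsatisfied (T₁ , T₂ , (T⊆ , _) , lift dep₁ , lift dep₂) =
    Theta-no-split {R = member T₁ ∘ encode} {C = member T₂ ∘ encode}
      (T⊆ ∘ encode∈T)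
      (λ r r′ → w-inj (dep₁ _ _ r r′ (trans val-x (sym val-x))))
      (λ c c′ → w′-inj (dep₂ _ _ c c′ (trans val-y (sym val-y))))

  restrict : Team X ℕ → Pred Edge 0ℓ → Team X ℕ
  restrict S P = record
    { member = λ s → member S s × P (decode s)
    ; resp   = λ s≈t (s∈S , p) → resp S s≈t s∈S , subst P (decode-cong s≈t) p
    }

  -- A member of `T` is fixed by its edge, so one edge per row makes every variable depend on `x`,
  -- and one per column on `y`.
  agree : ∀ {s t} → member T s → member T t → decode s ≡ decode t → s ≈ t
  agree (_ , s≈) (_ , t≈) eq v v∈X =
    trans (s≈ v v∈X) (trans (cong (λ e → val e v) eq) (sym (t≈ v v∈X)))

  small-satisfied : (S : Team X ℕ) → member S U.⊆ member T → AtMost k S →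
    S ⊨ dep x w ∨ dep y w′ [ id ]
  small-satisfied S S⊆T (L , |L|≤k , S⊆L , _)
    -- The at most `k` edges of `S` miss some `(i , i)` with `i ≤ k`, which serves as the deleted
    -- edge.
    with injection-avoids (≡-dec _≟_ _≟_) (λ i → i , i) (cong proj₁) (map decode L)
  ... | i , i≤ , i∉ =
    restrict S (ByRow (suc k) i) , restrict S (ByColumn i) ,
    (split , [ proj₁ , proj₁ ]′) ,
    lift (λ s t (s∈S , r) (t∈S , r′) eq →
      agree (S⊆T s∈S) (S⊆T t∈S)
        (cong₂ _,_ eq (ByRow-onePerRow i≤1+k r (subst (λ a → ByRow _ i (a , _)) (sym eq) r′)))
        w (there (here refl))) ,
    lift (λ s t (s∈S , c) (t∈S , c′) eq →
      agree (S⊆T s∈S) (S⊆T t∈S)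
        (cong₂ _,_ (ByColumn-onePerColumn c (subst (λ b → ByColumn i (_ , b)) (sym eq) c′)) eq)
        w′ (there (there (there (here refl)))))
    where
    i≤1+k : i ≤ suc k
    i≤1+k = m≤n⇒m≤1+n (≤-trans i≤ (≤-trans (≤-reflexive (length-map decode L)) |L|≤k))

    split : ∀ {s} → member S s →
      (member S s × ByRow (suc k) i (decode s)) ⊎ (member S s × ByColumn i (decode s))
    split {s} s∈S
      with Theta-split {i = i} (proj₁ (S⊆T s∈S))
             (λ eq → i∉ (subst (_∈ map decode L) eq (map⁺ (Any.map decode-cong (S⊆L s∈S)))))
    ... | inj₁ r = inj₁ (s∈S , r)
    ... | inj₂ c = inj₂ (s∈S , c)

theorem24 : (Var : Set) → DecidableEquality Var →
    (x y z : Var) → x ≢ y → x ≢ z → y ≢ z →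
    Incoherent (dep x y ∨ dep y x) ×
    Incoherent (dep x y ∨ dep y z) ×
    Incoherent (dep x z ∨ dep y z)
theorem24 Var _≟V_ x y z x≢y x≢z y≢z =
  incoherent x y y x val val-x val-y y-inj x-inj ,
  incoherent x y y z val val-x val-y y-inj z-injˡ ,
  incoherent x y z z val val-x val-y z-injʳ z-injˡ
  where
  -- All variables other than `x` and `y` share the value `a + b`, so `z` needs no test of its own.
  val : Edge → Var → ℕ
  val (a , b) v with v ≟V x | v ≟V y
  ... | yes _ | _     = a
  ... | no  _ | yes _ = b
  ... | no  _ | no  _ = a + b

  val-x : ∀ {e} → val e x ≡ proj₁ e
  val-x with x ≟V x | x ≟V y
  ... | yes _   | _ = refl
  ... | no  x≢x | _ = contradiction refl x≢x

  val-y : ∀ {e} → val e y ≡ proj₂ e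
  val-y with y ≟V x | y ≟V y
  ... | yes y≡x | _       = contradiction (sym y≡x) x≢y
  ... | no  _   | yes _   = refl
  ... | no  _   | no  y≢y = contradiction refl y≢y

  val-z : ∀ {e} → val e z ≡ proj₁ e + proj₂ e
  val-z with z ≟V x | z ≟V y
  ... | yes z≡x | _       = contradiction (sym z≡x) x≢z
  ... | no  _   | yes z≡y = contradiction (sym z≡y) y≢z
  ... | no  _   | no  _   = refl

  x-inj : ∀ {a a′ b} → val (a , b) x ≡ val (a′ , b) x → a ≡ a′
  x-inj eq = trans (sym val-x) (trans eq val-x)

  y-inj : ∀ {a b b′} → val (a , b) y ≡ val (a , b′) y → b ≡ b′
  y-inj eq = trans (sym val-y) (trans eq val-y)

  z-injˡ : ∀ {a a′ b} → val (a , b) z ≡ val (a′ , b) z → a ≡ a′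
  z-injˡ {b = b} eq = +-cancelʳ-≡ b _ _ (trans (sym val-z) (trans eq val-z))

  z-injʳ : ∀ {a b b′} → val (a , b) z ≡ val (a , b′) z → b ≡ b′
  z-injʳ {a} eq = +-cancelˡ-≡ a _ _ (trans (sym val-z) (trans eq val-z))
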